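{- Let $\mathbf P=(P,\leq)$ be a partially ordered set with maximum $1$ and let $a \in P$. The following conditions are equivalent. (1) The element $a$ is a non-generator. (2) Both (i) $a \leq p$ for every maximal$_{<1}$ element $p$ of $\mathbf P$, and (ii) for every $e \in P$ such that $e<1$ and $e$ cannot be extended to a maximal$_{<1}$ element, there is $r \in P$ such that $r<1$, $a<r$ and $e<r$. (3) Both (i) $a \leq p$ for every maximal$_{<1}$ element $p$ of $\mathbf P$, and (iii) for every unbounded$_{<1}$ chain $(e_i)_{i\in I}$ in $\mathbf P$ and for every $i \in I$, there is $r \in P$ such that $r<1$, $a \leq r$ and $e_i \leq r$. (4) Both (i) $a \leq p$ for every maximal$_{<1}$ element $p$ of $\mathbf P$, and (iv) whenever $(e_i)_{i \in I}$ is an unbounded$_{<1}$ chain in $\mathbf P$ such that no element of the chain can be extended to a maximal$_{<1}$ element, then for every $i\in I$ there is $r \in P$ such that $r<1$, $a \leq r$ and $e_i \leq r$. Moreover, in (iii) and in (iv) "for every $i \in I$" can be equivalently replaced by "for some $i \in I$" (that is, the equivalence of all the conditions remains true with this replacement).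
   Context: Let $\mathbf P=(P,\leq)$ be a poset with maximum $1$ (not assumed to be a semilattice). For $a,e \in P$, "$a \vee e = 1$" means that there is no $p \in P$ such that $p<1$, $a \leq p$ and $e \leq p$. An element $a\in P$ is a non-generator if, for every $e \in P$, $a\vee e=1$ implies $e=1$. An element $p\in P$ is maximal$_{<1}$ if $p<1$ and there is no $q \in P$ such that $p<q<1$. An element $e\in P$ can be extended to a maximal$_{<1}$ element if there is a maximal$_{<1}$ element $p$ with $e \leq p$. A chain is a nonempty subset that is linearly ordered by the induced order; chains are denoted as families $(e_i)_{i\in I}$. A chain $(e_i)_{i \in I}$ in $\mathbf P$ is unbounded$_{<1}$ if $e_i<1$ for every $i\in I$ and there is no $p\in P$ such that $p<1$ and $e_i\leq p$ for every $i \in I$. -}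

module Defs where

open import Level using (Level; suc; _⊔_)
open import Data.Product using (_×_; ∃-syntax)
open import Relation.Binary.Bundles using (Poset)
open import Relation.Binary.Definitions using (Total)
open import Relation.Nullary using (¬_)
import Relation.Binary.Properties.Poset as PosetProperties

-- `1ₚ` is only an element here; that it is the maximum of `P` is a hypothesis
-- of the theorem.
module _ {c ℓ₁ ℓ₂ : Level} (P : Poset c ℓ₁ ℓ₂) (1ₚ : Poset.Carrier P) where

  open Poset P
  open PosetProperties P using (_<_)

  -- a ∨ e = 1.  P need not have joins, so this is a relation on pairs of
  -- elements and not an equation about a join operation.
  JoinIsOne : Carrier → Carrier → Set (c ⊔ ℓ₁ ⊔ ℓ₂)
  JoinIsOne a e = ¬ (∃[ p ] p < 1ₚ × a ≤ p × e ≤ p)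

  NonGenerator : Carrier → Set (c ⊔ ℓ₁ ⊔ ℓ₂)
  NonGenerator a = ∀ e → JoinIsOne a e → e ≈ 1ₚ

  Maximal<1 : Carrier → Set (c ⊔ ℓ₁ ⊔ ℓ₂)
  Maximal<1 p = p < 1ₚ × ¬ (∃[ q ] p < q × q < 1ₚ)

  ExtendsToMaximal<1 : Carrier → Set (c ⊔ ℓ₁ ⊔ ℓ₂)
  ExtendsToMaximal<1 e = ∃[ p ] Maximal<1 p × e ≤ p

  -- The chain is the set of values of `elem`; repetitions are harmless, and a
  -- subset of `Carrier` is the family indexed by its own elements.  Classically
  -- a subset is given by a map `Carrier → Bool`, so `Set c` has enough index
  -- types to represent every chain.
  record Chain : Set (suc c ⊔ ℓ₂) where
    field
      Index    : Set c
      elem     : Index → Carrier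
      nonempty : Index
      linear   : Total (λ i j → elem i ≤ elem j)

  Unbounded<1 : Chain → Set (c ⊔ ℓ₁ ⊔ ℓ₂)
  Unbounded<1 C = (∀ i → elem i < 1ₚ) × ¬ (∃[ p ] p < 1ₚ × (∀ i → elem i ≤ p))
    where open Chain C

  module _ (a : Carrier) where

    Condition-i : Set (c ⊔ ℓ₁ ⊔ ℓ₂)
    Condition-i = ∀ p → Maximal<1 p → a ≤ p

    Condition-ii : Set (c ⊔ ℓ₁ ⊔ ℓ₂)
    Condition-ii = ∀ e → e < 1ₚ → ¬ ExtendsToMaximal<1 e →
                   ∃[ r ] r < 1ₚ × a < r × e < r

    Condition-iii : Set (suc c ⊔ ℓ₁ ⊔ ℓ₂)
    Condition-iii = (C : Chain) → let open Chain C in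
                    Unbounded<1 C →
                    ∀ i → ∃[ r ] r < 1ₚ × a ≤ r × elem i ≤ r

    Condition-iii-some : Set (suc c ⊔ ℓ₁ ⊔ ℓ₂)
    Condition-iii-some = (C : Chain) → let open Chain C in
                         Unbounded<1 C →
                         ∃[ i ] ∃[ r ] r < 1ₚ × a ≤ r × elem i ≤ r

    Condition-iv : Set (suc c ⊔ ℓ₁ ⊔ ℓ₂)
    Condition-iv = (C : Chain) → let open Chain C in
                   Unbounded<1 C → (∀ i → ¬ ExtendsToMaximal<1 (elem i)) →
                   ∀ i → ∃[ r ] r < 1ₚ × a ≤ r × elem i ≤ r

    Condition-iv-some : Set (suc c ⊔ ℓ₁ ⊔ ℓ₂)
    Condition-iv-some = (C : Chain) → let open Chain C in
                        Unbounded<1 C → (∀ i → ¬ ExtendsToMaximal<1 (elem i)) →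
                        ∃[ i ] ∃[ r ] r < 1ₚ × a ≤ r × elem i ≤ r

{-# OPTIONS --safe #-}

-- Condition (i) disposes of every e that extends to a maximal<1 element.  If
-- e < 1 does not extend, then the interval [e, 1) has no maximal element, so by
-- Zorn's lemma it contains a chain without upper bound in [e, 1).  This chain is
-- unbounded<1 in P, and a bound for a and a single one of its elements is
-- already a bound for a and e.
--
-- `ExcludedMiddle` decides arbitrary types, so it also chooses elements; with
-- extensionality the choice depends only on the extension of a Bool-valued
-- subset.  Such subsets stay in `Set c`, which makes the union of all stages of
-- the transfinite construction of a chain available.
module Submission where

open import Defs
open import Level using (Level; _⊔_; 0ℓ; Lift; lift; lower)
open import Axiom.ExcludedMiddle using (ExcludedMiddle)
open import Axiom.Extensionality.Propositional using (Extensionality)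
open import Data.Bool using (Bool; true)
open import Data.Bool.Properties using (⇔→≡)
open import Data.Maybe using (Maybe; just; nothing)
open import Data.Maybe.Properties using (just-injective)
open import Data.Product using (_×_; _,_; proj₁; proj₂; ∃-syntax)
open import Data.Sum using (_⊎_; inj₁; inj₂)
open import Function.Base using (_∘_)
open import Function.Bundles using (_⇔_; mk⇔)
open import Relation.Binary.Bundles using (Poset)
open import Relation.Binary.Core using (Rel)
open import Relation.Binary.Definitions using (Maximum)
open import Relation.Binary.PropositionalEquality using (_≡_; refl; sym; trans; subst)
import Relation.Binary.Construct.NonStrictToStrict as NonStrictToStrict
import Relation.Binary.Properties.Poset as PosetProperties
open import Relation.Nullary using (¬_; yes; no; does; contradiction)
open import Relation.Nullary.Decidable using (map′; decidable-stable)

-- Bool-valued subsets under excluded middle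

em-lower : ∀ {a} b → ExcludedMiddle (a ⊔ b) → ExcludedMiddle a
em-lower b em = map′ lower lift (em {Lift b _})

module _ {c} {A : Set c} where

  infix 4 _∈_ _⊆_

  _∈_ : A → (A → Bool) → Set
  x ∈ S = S x ≡ true

  _⊆_ : Rel (A → Bool) c
  S ⊆ T = ∀ x → x ∈ S → x ∈ T

  ⊆-antisym : Extensionality c 0ℓ → ∀ {S T} → S ⊆ T → T ⊆ S → S ≡ T
  ⊆-antisym ext S⊆T T⊆S = ext λ x → ⇔→≡ (mk⇔ (S⊆T x) (T⊆S x))

  module Comprehension {p} (em : ExcludedMiddle p) (Q : A → Set p) where

    ⟪_⟫ : A → Bool
    ⟪_⟫ x = does (em {Q x})

    ∈⟪⟫⁺ : ∀ {x} → Q x → x ∈ ⟪_⟫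
    ∈⟪⟫⁺ {x} q with em {Q x}
    ... | yes _ = refl
    ... | no ¬q = contradiction q ¬q

    ∈⟪⟫⁻ : ∀ {x} → x ∈ ⟪_⟫ → Q x
    ∈⟪⟫⁻ {x} x∈ with em {Q x}
    ... | yes q = q
    ∈⟪⟫⁻ {x} () | no _

-- Zorn's lemma by a tower of stages

module Zorn
  {c p ℓ} {A : Set c} (U : A → Set p) (_<_ : Rel A ℓ)
  (<-irrefl : ∀ {x} → ¬ (x < x))
  (em : ExcludedMiddle (c ⊔ p ⊔ ℓ)) (ext : Extensionality c 0ℓ) where

  private
    emᶜ : ExcludedMiddle c
    emᶜ = em-lower (p ⊔ ℓ) em

  StrictBound : (A → Bool) → A → Set _
  StrictBound S y = U y × (∀ x → x ∈ S → x < y)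

  Connected : (A → Bool) → Set _
  Connected S = ∀ x y → x ∈ S → y ∈ S → x ≡ y ⊎ x < y ⊎ y < x

  bound : (A → Bool) → Maybe A
  bound S with em {∃[ y ] StrictBound S y}
  ... | yes (y , _) = just y
  ... | no  _       = nothing

  bound-strict : ∀ S {y} → bound S ≡ just y → StrictBound S y
  bound-strict S eq with em {∃[ y ] StrictBound S y}
  bound-strict S refl | yes (_ , b) = b
  bound-strict S ()   | no _

  bound-exists : ∀ S {y} → StrictBound S y → ∃[ z ] bound S ≡ just z
  bound-exists S b with em {∃[ y ] StrictBound S y}
  ... | yes (z , _) = z , refl
  ... | no ¬b       = contradiction (_ , b) ¬b

  module Next (S : A → Bool) =
    Comprehension emᶜ (λ x → x ∈ S ⊎ bound S ≡ just x)
  module Union (F : (A → Bool) → Bool) =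
    Comprehension emᶜ (λ x → ∃[ S ] S ∈ F × x ∈ S)

  next : (A → Bool) → A → Bool
  next = Next.⟪_⟫

  ⋃ : ((A → Bool) → Bool) → A → Bool
  ⋃ = Union.⟪_⟫

  ⊆-next : ∀ S → S ⊆ next S
  ⊆-next S _ x∈S = Next.∈⟪⟫⁺ S (inj₁ x∈S)

  -- The tower generated by `next` and `⋃`, in place of recursion over ordinals. The empty subset is
  -- the union of the empty family, so there is no base constructor.
  data Stage : (A → Bool) → Set c where
    next-stage : ∀ {S} → Stage S → Stage (next S)
    ⋃-stage    : ∀ {F} → (∀ S → S ∈ F → Stage S) → Stage (⋃ F)

  -- Induction on both stages at once: when `T` is a successor, comparing its predecessor with `S`
  -- in both directions leaves open only mutual inclusion.
  compare : ∀ {S T} → Stage S → Stage T → T ⊆ S ⊎ next S ⊆ T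
  compare {S} s (next-stage {T} t) with compare s t | compare t s
  ... | inj₂ nS⊆T | _         = inj₂ λ x → ⊆-next T x ∘ nS⊆T x
  ... | inj₁ _    | inj₂ nT⊆S = inj₁ nT⊆S
  ... | inj₁ T⊆S  | inj₁ S⊆T  =
    -- Extensionality identifies `S` with `T`, and hence the bounds chosen for them.
    inj₂ (subst (λ R → next S ⊆ next R) (⊆-antisym ext S⊆T T⊆S) λ _ x∈ → x∈)
  compare {S} s (⋃-stage {F} t)
    -- A single member containing `next S` settles the union; failing that, each member lies in `S`.
    with emᶜ {∃[ T ] T ∈ F × next S ⊆ T}
  ... | yes (T , T∈F , nS⊆T) =
    inj₂ λ x x∈ → Union.∈⟪⟫⁺ F (T , T∈F , nS⊆T x x∈)
  ... | no ¬above = inj₁ λ x x∈⋃ → below x (Union.∈⟪⟫⁻ F x∈⋃)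
    where
    below : ∀ x → ∃[ T ] T ∈ F × x ∈ T → x ∈ S
    below x (T , T∈F , x∈T) with compare s (t T T∈F)
    ... | inj₁ T⊆S  = T⊆S x x∈T
    ... | inj₂ nS⊆T = contradiction (T , T∈F , nS⊆T) ¬above

  Stage⇒⊆U : ∀ {S} → Stage S → ∀ x → x ∈ S → U x
  Stage⇒⊆U (next-stage {S} s) x x∈ with Next.∈⟪⟫⁻ S x∈
  ... | inj₁ x∈S = Stage⇒⊆U s x x∈S
  ... | inj₂ eq  = proj₁ (bound-strict S eq)
  Stage⇒⊆U (⋃-stage {F} s) x x∈ with Union.∈⟪⟫⁻ F x∈
  ... | S , S∈F , x∈S = Stage⇒⊆U (s S S∈F) x x∈S

  -- An adjoined bound lies strictly above everything before it; in a union, two elements share the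
  -- larger of their two comparable stages.
  Stage⇒Connected : ∀ {S} → Stage S → Connected S
  Stage⇒Connected (next-stage {S} s) x y x∈ y∈
    with Next.∈⟪⟫⁻ S x∈ | Next.∈⟪⟫⁻ S y∈
  ... | inj₁ x∈S | inj₁ y∈S = Stage⇒Connected s x y x∈S y∈S
  ... | inj₁ x∈S | inj₂ eqy = inj₂ (inj₁ (proj₂ (bound-strict S eqy) x x∈S))
  ... | inj₂ eqx | inj₁ y∈S = inj₂ (inj₂ (proj₂ (bound-strict S eqx) y y∈S))
  ... | inj₂ eqx | inj₂ eqy = inj₁ (just-injective (trans (sym eqx) eqy))
  Stage⇒Connected (⋃-stage {F} s) x y x∈ y∈
    with Union.∈⟪⟫⁻ F x∈ | Union.∈⟪⟫⁻ F y∈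
  ... | S , S∈F , x∈S | T , T∈F , y∈T with compare (s S S∈F) (s T T∈F)
  ...   | inj₁ T⊆S  = Stage⇒Connected (s S S∈F) x y x∈S (T⊆S y y∈T)
  ...   | inj₂ nS⊆T =
    Stage⇒Connected (s T T∈F) x y (nS⊆T x (⊆-next S x x∈S)) y∈T

  -- The union of all stages is itself a stage. If it had a strict bound, `next` would adjoin some
  -- `z` to it; the enlarged stage is again part of the union, whence `z < z`.
  unboundedChain : ∃[ S ] (∀ x → x ∈ S → U x) × Connected S
                        × ¬ (∃[ y ] StrictBound S y)
  unboundedChain =
    last , Stage⇒⊆U last-stage , Stage⇒Connected last-stage , noBound
    where
    module Stages = Comprehension emᶜ Stage

    last : A → Bool
    last = ⋃ Stages.⟪_⟫

    last-stage : Stage last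
    last-stage = ⋃-stage λ _ → Stages.∈⟪⟫⁻

    noBound : ¬ (∃[ y ] StrictBound last y)
    noBound (_ , b) with bound-exists last b
    ... | z , eq = <-irrefl (proj₂ (bound-strict last eq) z z∈last)
      where
      z∈last : z ∈ last
      z∈last = Union.∈⟪⟫⁺ Stages.⟪_⟫
        ( next last , Stages.∈⟪⟫⁺ (next-stage last-stage)
        , Next.∈⟪⟫⁺ last (inj₂ eq))

-- Unbounded chains in the poset

module _ {c ℓ₁ ℓ₂} (em : ExcludedMiddle (c ⊔ ℓ₁ ⊔ ℓ₂))
  (P : Poset c ℓ₁ ℓ₂) (1ₚ : Poset.Carrier P) where

  open Poset P using (Carrier; _≈_; _≤_; antisym; ≤-respˡ-≈; module Eq)
    renaming (refl to ≤-refl; reflexive to ≤-reflexive; trans to ≤-trans)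
  open PosetProperties P using (_<_; <-irrefl)

  ≤-<-trans : ∀ {x y z} → x ≤ y → y < z → x < z
  ≤-<-trans = NonStrictToStrict.≤-<-trans _≈_ _≤_ ≤-trans antisym ≤-respˡ-≈

  ¬Maximal⇒∃> : ∀ {p} → p < 1ₚ → ¬ Maximal<1 P 1ₚ p → ∃[ q ] p < q × q < 1ₚ
  ¬Maximal⇒∃> p<1 ¬max = decidable-stable em λ ¬q → ¬max (p<1 , ¬q)

  ¬Extends-≥ : ∀ {x y} → x ≤ y →
               ¬ ExtendsToMaximal<1 P 1ₚ x → ¬ ExtendsToMaximal<1 P 1ₚ y
  ¬Extends-≥ x≤y ¬ext (p , max , y≤p) = ¬ext (p , max , ≤-trans x≤y y≤p)

  -- Zorn's lemma excludes only strict bounds. A weak bound below `1ₚ` lies above `e`, so it is not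
  -- maximal<1 and can be pushed up to a strict bound.
  unboundedChainAbove :
    Extensionality c 0ℓ → ∀ e → e < 1ₚ → ¬ ExtendsToMaximal<1 P 1ₚ e →
    ∃[ C ] Unbounded<1 P 1ₚ C × (∀ i → e ≤ Chain.elem C i)
  unboundedChainAbove ext e e<1 ¬ext =
    C , ((λ (x , x∈S) → proj₂ (S⊆U x x∈S)) , noUpperBound) ,
    λ (x , x∈S) → proj₁ (S⊆U x x∈S)
    where
    U : Carrier → Set _
    U x = e ≤ x × x < 1ₚ

    module Z = Zorn U _<_ (<-irrefl Eq.refl) em ext

    S : Carrier → Bool
    S = proj₁ Z.unboundedChain

    S⊆U : ∀ x → x ∈ S → U x
    S⊆U = proj₁ (proj₂ Z.unboundedChain)

    noStrictBound : ¬ (∃[ y ] Z.StrictBound S y)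
    noStrictBound = proj₂ (proj₂ (proj₂ Z.unboundedChain))

    S-nonempty : ∃[ x ] x ∈ S
    S-nonempty = decidable-stable (em-lower (ℓ₁ ⊔ ℓ₂) em) λ empty →
      -- If `S` were empty, `e` would be a strict bound vacuously.
      noStrictBound
        (e , (≤-refl , e<1) , λ x x∈S → contradiction (x , x∈S) empty)

    S-linear : (i j : ∃[ x ] x ∈ S) →
               proj₁ i ≤ proj₁ j ⊎ proj₁ j ≤ proj₁ i
    S-linear (x , x∈S) (y , y∈S)
      with proj₁ (proj₂ (proj₂ Z.unboundedChain)) x y x∈S y∈S
    ... | inj₁ refl             = inj₁ ≤-refl
    ... | inj₂ (inj₁ (x≤y , _)) = inj₁ x≤y
    ... | inj₂ (inj₂ (y≤x , _)) = inj₂ y≤x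

    C : Chain P 1ₚ
    C = record
      { Index    = ∃[ x ] x ∈ S
      ; elem     = proj₁
      ; nonempty = S-nonempty
      ; linear   = S-linear
      }

    noUpperBound : ¬ (∃[ p ] p < 1ₚ × ((i : ∃[ x ] x ∈ S) → proj₁ i ≤ p))
    noUpperBound (p , p<1 , S≤p) =
      -- Any element of `S` lies between `e` and `p`, so maximality of `p` would extend `e`.
      let x , x∈S       = S-nonempty
          e≤p           = ≤-trans (proj₁ (S⊆U x x∈S)) (S≤p (x , x∈S))
          q , p<q , q<1 = ¬Maximal⇒∃> p<1 λ max → ¬ext (p , max , e≤p)
      in noStrictBound
           ( q , (≤-trans e≤p (proj₁ p<q) , q<1)
           , λ y y∈S → ≤-<-trans (S≤p (y , y∈S)) p<q)

  -- Equivalence of the conditions on `a`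

  module _ (a : Carrier) where

    nonGenerator⇒bounded : NonGenerator P 1ₚ a → ∀ e → e < 1ₚ →
                           ∃[ r ] r < 1ₚ × a ≤ r × e ≤ r
    nonGenerator⇒bounded ng e (_ , e≉1) = decidable-stable em (e≉1 ∘ ng e)

    -- A common bound `r < 1ₚ` of `a` and a maximal<1 element `p` can only be `p` itself, up to `≈`.
    nonGenerator⇒i : NonGenerator P 1ₚ a → Condition-i P 1ₚ a
    nonGenerator⇒i ng p (p<1 , noneAbove)
      with nonGenerator⇒bounded ng p p<1
    ... | r , r<1 , a≤r , p≤r = ≤-trans a≤r (≤-reflexive (Eq.sym p≈r))
      where
      p≈r : p ≈ r
      p≈r = decidable-stable (em-lower (c ⊔ ℓ₂) em) λ p≉r →
        noneAbove (r , (p≤r , p≉r) , r<1)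

    nonGenerator⇒ii : NonGenerator P 1ₚ a → Condition-ii P 1ₚ a
    nonGenerator⇒ii ng e e<1 ¬ext =
      let r , r<1 , a≤r , e≤r = nonGenerator⇒bounded ng e e<1
          -- `r` may coincide with `a` or `e`. Being above `e` it is not maximal<1, and moving up to
          -- `q` makes both inequalities strict.
          q , r<q , q<1       = ¬Maximal⇒∃> r<1 λ max → ¬ext (r , max , e≤r)
      in q , q<1 , ≤-<-trans a≤r r<q , ≤-<-trans e≤r r<q

    nonGenerator⇒iii : NonGenerator P 1ₚ a → Condition-iii P 1ₚ a
    nonGenerator⇒iii ng C (C<1 , _) i =
      nonGenerator⇒bounded ng (Chain.elem C i) (C<1 i)

    iii⇒iv : Condition-iii P 1ₚ a → Condition-iv P 1ₚ a
    iii⇒iv iii C unb _ = iii C unb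

    iii⇒iii-some : Condition-iii P 1ₚ a → Condition-iii-some P 1ₚ a
    iii⇒iii-some iii C unb = Chain.nonempty C , iii C unb (Chain.nonempty C)

    iv⇒iv-some : Condition-iv P 1ₚ a → Condition-iv-some P 1ₚ a
    iv⇒iv-some iv C unb ¬ext =
      Chain.nonempty C , iv C unb ¬ext (Chain.nonempty C)

    iii-some⇒iv-some : Condition-iii-some P 1ₚ a → Condition-iv-some P 1ₚ a
    iii-some⇒iv-some iii C unb _ = iii C unb

    -- Common core of the converses. A maximal<1 element above `e` would by (i) also bound `a`,
    -- against `join`; so `bounded` applies and contradicts `join` again.
    nonGenerator⁺ : Maximum _≤_ 1ₚ → Condition-i P 1ₚ a →
      (∀ e → e < 1ₚ → ¬ ExtendsToMaximal<1 P 1ₚ e →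
        ∃[ r ] r < 1ₚ × a ≤ r × e ≤ r) →
      NonGenerator P 1ₚ a
    nonGenerator⁺ ≤1 i bounded e join =
      decidable-stable (em-lower (c ⊔ ℓ₂) em) λ e≉1 →
        join (bounded e (≤1 e , e≉1) λ (p , max@(p<1 , _) , e≤p) →
          join (p , p<1 , i p max , e≤p))

    i×ii⇒nonGenerator : Maximum _≤_ 1ₚ →
      Condition-i P 1ₚ a → Condition-ii P 1ₚ a → NonGenerator P 1ₚ a
    i×ii⇒nonGenerator ≤1 i ii = nonGenerator⁺ ≤1 i λ e e<1 ¬ext →
      let r , r<1 , (a≤r , _) , (e≤r , _) = ii e e<1 ¬ext
      in r , r<1 , a≤r , e≤r

    -- The "for some" form of (iv) follows from each of the other chain conditions, so this
    -- implication serves all four. It applies to a chain above `e` because extending any of its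
    -- elements would extend `e`.
    i×iv-some⇒nonGenerator : Extensionality c 0ℓ → Maximum _≤_ 1ₚ →
      Condition-i P 1ₚ a → Condition-iv-some P 1ₚ a → NonGenerator P 1ₚ a
    i×iv-some⇒nonGenerator ext ≤1 i iv = nonGenerator⁺ ≤1 i λ e e<1 ¬ext →
      let C , unb , e≤C           = unboundedChainAbove ext e e<1 ¬ext
          j , r , r<1 , a≤r , x≤r = iv C unb λ k → ¬Extends-≥ (e≤C k) ¬ext
      in r , r<1 , a≤r , ≤-trans (e≤C j) x≤r

theorem2p3 : ∀ {c ℓ₁ ℓ₂ : Level} →
    ExcludedMiddle (c ⊔ ℓ₁ ⊔ ℓ₂) → Extensionality c 0ℓ →
    (P : Poset c ℓ₁ ℓ₂) (1ₚ : Poset.Carrier P) → Maximum (Poset._≤_ P) 1ₚ →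
    (a : Poset.Carrier P) →
    (NonGenerator P 1ₚ a ⇔ (Condition-i P 1ₚ a × Condition-ii P 1ₚ a))
    × (NonGenerator P 1ₚ a ⇔ (Condition-i P 1ₚ a × Condition-iii P 1ₚ a))
    × (NonGenerator P 1ₚ a ⇔ (Condition-i P 1ₚ a × Condition-iv P 1ₚ a))
    × (NonGenerator P 1ₚ a ⇔ (Condition-i P 1ₚ a × Condition-iii-some P 1ₚ a))
    × (NonGenerator P 1ₚ a ⇔ (Condition-i P 1ₚ a × Condition-iv-some P 1ₚ a))
theorem2p3 em ext P 1ₚ ≤1 a =
    mk⇔ (λ ng → toI ng , nonGenerator⇒ii em P 1ₚ a ng)
        (λ (i , ii) → i×ii⇒nonGenerator em P 1ₚ a ≤1 i ii)
  , mk⇔ (λ ng → toI ng , toIII ng)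
        (λ (i , iii) → fromIV i (toIV-some (iii⇒iv em P 1ₚ a iii)))
  , mk⇔ (λ ng → toI ng , iii⇒iv em P 1ₚ a (toIII ng))
        (λ (i , iv) → fromIV i (toIV-some iv))
  , mk⇔ (λ ng → toI ng , iii⇒iii-some em P 1ₚ a (toIII ng))
        (λ (i , iii) → fromIV i (iii-some⇒iv-some em P 1ₚ a iii))
  , mk⇔ (λ ng → toI ng , toIV-some (iii⇒iv em P 1ₚ a (toIII ng)))
        (λ (i , iv) → fromIV i iv)
  where
  toI       = nonGenerator⇒i em P 1ₚ a
  toIII     = nonGenerator⇒iii em P 1ₚ a
  toIV-some = iv⇒iv-some em P 1ₚ a
  fromIV    = i×iv-some⇒nonGenerator em P 1ₚ a ext ≤1
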